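{- For $n\ge 0$ let $s_n=\sum_{r=0}^{n}1/r!$ be the $n$th partial sum of the Taylor series $e=\sum_{r\ge 0}1/r!$. For every $n\ge 0$, at most two of the three numbers $s_n, s_{n+1}, s_{n+2}$ are convergents of the simple continued fraction expansion of $e$.
   Context: The convergents of $e$ are the rationals obtained by truncating the simple continued fraction expansion of $e$; a partial sum $s_n$ "is a convergent" if it equals one of these rationals. -}

module Defs where

open import Data.Nat.Base as ℕ using (ℕ; zero; suc; _!; z≤n; s≤s)
import Data.Nat.Properties as ℕ
open import Data.Nat.Tactic.RingSolver using (solve-∀)
open import Data.Integer.Base as ℤ using (ℤ; +_; +[1+_]; -[1+_])
import Data.Integer.Properties as ℤ
open import Data.Rational.Base
open import Data.Rational.Properties
open import Data.Rational.Unnormalised.Base as ℚᵘ using (ℚᵘ; mkℚᵘ; *≤*; *<*)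
import Data.Rational.Unnormalised.Properties as ℚᵘ
open import Data.Product.Base using (Σ; Σ-syntax; ∃-syntax; _×_; _,_)
open import Data.Sum.Base using (inj₁; inj₂)
open import Function.Base using (_∘_)
open import Relation.Binary.PropositionalEquality

record ℝ : Set where
  field
    approx : ℕ → ℚ
    cauchy : ∀ ε → 0ℚ < ε →
             ∃[ N ] (∀ m n → N ℕ.≤ m → N ℕ.≤ n → ∣ approx m - approx n ∣ < ε)

open ℝ public

_⟶_ : (ℕ → ℚ) → ℝ → Set
u ⟶ x = ∀ ε → 0ℚ < ε → ∃[ N ] (∀ n → N ℕ.≤ n → ∣ u n - approx x n ∣ < ε)

-- Partial quotients of an infinite simple continued fraction
--   a 0 + 1/(a 1 + 1/(a 2 + ⋯)).
-- Only a 0 may fail to be positive.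
record SimpleCF : Set where
  field
    quotient : ℕ → ℤ
    quotient>0 : ∀ i → ℤ.Positive (quotient (suc i))

open SimpleCF public

tail : SimpleCF → SimpleCF
tail c = record { quotient = quotient c ∘ suc ; quotient>0 = quotient>0 c ∘ suc }

n/1-pos : ∀ i → ℤ.Positive i → Positive (i / 1)
n/1-pos +[1+ n ] _ = normalize-pos (suc n) 1

mutual
  -- truncation c k is a 0 + 1/(a 1 + ⋯ + 1/a k).
  truncation : SimpleCF → ℕ → ℚ
  truncation c zero    = quotient c 0 / 1
  truncation c (suc k) =
    quotient c 0 / 1 + (1/ truncation (tail c) k) {{truncation-tail≢0 c k}}

  truncation-tail≢0 : ∀ c k → NonZero (truncation (tail c) k)
  truncation-tail≢0 c k =
    pos⇒nonZero (truncation (tail c) k) {{truncation-pos (tail c) k (quotient>0 c 0)}}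

  truncation-pos : ∀ c k → ℤ.Positive (quotient c 0) → Positive (truncation c k)
  truncation-pos c zero    a₀>0 = n/1-pos (quotient c 0) a₀>0
  truncation-pos c (suc k) a₀>0 =
    pos+pos⇒pos (quotient c 0 / 1) {{n/1-pos (quotient c 0) a₀>0}} _
      {{1/pos⇒pos (truncation (tail c) k)
          {{truncation-pos (tail c) k (quotient>0 c 0)}}}}

-- SimpleCF contains only infinite continued fractions, so a rational x has no
-- expansion in this sense; an irrational x has exactly one.
IsExpansionOf : SimpleCF → ℝ → Set
IsExpansionOf c x = truncation c ⟶ x

_IsConvergentOf_ : ℚ → ℝ → Set
r IsConvergentOf x = Σ[ c ∈ SimpleCF ] (IsExpansionOf c x × ∃[ k ] r ≡ truncation c k)

taylorTerm : ℕ → ℚ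
taylorTerm n = (+ 1 / (n !)) {{n ℕ.!≢0}}

partialSum : ℕ → ℚ
partialSum zero    = taylorTerm 0
partialSum (suc n) = partialSum n + taylorTerm (suc n)

private
  unit : ∀ d → .{{ℕ.NonZero d}} → ℚ
  unit d = + 1 / d

  toℚᵘ-unit : ∀ d → toℚᵘ (unit (suc d)) ℚᵘ.≃ mkℚᵘ (+ 1) d
  toℚᵘ-unit d = toℚᵘ-fromℚᵘ (mkℚᵘ (+ 1) d)

  unit-pos : ∀ d .{{_ : ℕ.NonZero d}} → Positive (unit d)
  unit-pos d = normalize-pos 1 d

  lem : ∀ d e → (1 ℕ.* suc e ℕ.+ 1 ℕ.* suc e) ℕ.* suc d ≡ (2 ℕ.* suc d) ℕ.* suc e
  lem = solve-∀

  unit-double : ∀ d d′ .{{_ : ℕ.NonZero d}} .{{_ : ℕ.NonZero d′}} →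
                2 ℕ.* d ℕ.≤ d′ → unit d′ + unit d′ ≤ unit d
  unit-double (suc d) (suc e) h = toℚᵘ-cancel-≤ (begin
    toℚᵘ (unit (suc e) + unit (suc e))
      ≃⟨ toℚᵘ-homo-+ (unit (suc e)) (unit (suc e)) ⟩
    toℚᵘ (unit (suc e)) ℚᵘ.+ toℚᵘ (unit (suc e))
      ≃⟨ ℚᵘ.+-cong (toℚᵘ-unit e) (toℚᵘ-unit e) ⟩
    mkℚᵘ (+ 1) e ℚᵘ.+ mkℚᵘ (+ 1) e
      ≤⟨ *≤* (ℤ.+≤+ bound) ⟩
    mkℚᵘ (+ 1) d
      ≃⟨ toℚᵘ-unit d ⟨
    toℚᵘ (unit (suc d)) ∎)
    where
    open ℚᵘ.≤-Reasoning
    bound : (1 ℕ.* suc e ℕ.+ 1 ℕ.* suc e) ℕ.* suc d ℕ.≤ 1 ℕ.* (suc e ℕ.* suc e)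
    bound = subst₂ ℕ._≤_ (sym (lem d e)) (sym (ℕ.*-identityˡ (suc e ℕ.* suc e)))
              (ℕ.*-monoˡ-≤ (suc e) h)

  unit-small : ∀ ε → 0ℚ < ε → ∀ d .{{_ : ℕ.NonZero d}} → ↧ₙ ε ℕ.< d → unit d < ε
  unit-small ε@(mkℚ +[1+ n ] b _) _ (suc d) h = toℚᵘ-cancel-< (begin-strict
    toℚᵘ (unit (suc d))  ≃⟨ toℚᵘ-unit d ⟩
    mkℚᵘ (+ 1) d         <⟨ *<* (ℤ.+<+ bound) ⟩
    toℚᵘ ε               ∎)
    where
    open ℚᵘ.≤-Reasoning
    bound : 1 ℕ.* suc b ℕ.< suc n ℕ.* suc d
    bound = subst (ℕ._< suc n ℕ.* suc d) (sym (ℕ.*-identityˡ (suc b)))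
              (ℕ.<-≤-trans h (ℕ.m≤n*m (suc d) (suc n)))
  unit-small (mkℚ (+ 0) _ _) (*<* (ℤ.+<+ ()))
  unit-small (mkℚ -[1+ _ ] _ _) (*<* ())

  taylorTerm-nonNeg : ∀ n → 0ℚ ≤ taylorTerm n
  taylorTerm-nonNeg n = <⇒≤ (positive⁻¹ _ {{unit-pos (n !) {{n ℕ.!≢0}}}})

  n≤n! : ∀ n → n ℕ.≤ n !
  n≤n! zero    = z≤n
  n≤n! (suc n) = ℕ.m≤m*n (suc n) (n !) {{n ℕ.!≢0}}

  p≤p+q : ∀ p {q} → 0ℚ ≤ q → p ≤ p + q
  p≤p+q p 0≤q = ≤-trans (≤-reflexive (sym (+-identityʳ p))) (+-monoʳ-≤ p 0≤q)

  lower : ∀ N k → partialSum N ≤ partialSum (k ℕ.+ N)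
  lower N zero    = ≤-refl
  lower N (suc k) = ≤-trans (lower N k) (p≤p+q _ (taylorTerm-nonNeg (suc (k ℕ.+ N))))

  -- partialSum n + taylorTerm n is antitone for n ≥ 1
  upper : ∀ N k → partialSum (k ℕ.+ suc N) + taylorTerm (k ℕ.+ suc N) ≤ partialSum (suc N) + taylorTerm (suc N)
  upper N zero    = ≤-refl
  upper N (suc k) = ≤-trans
    (≤-trans (≤-reflexive (+-assoc (partialSum m) (taylorTerm (suc m)) (taylorTerm (suc m))))
      (+-monoʳ-≤ (partialSum m)
        (unit-double (m !) (suc m !) {{m ℕ.!≢0}} {{suc m ℕ.!≢0}}
          (ℕ.*-monoˡ-≤ (m !) (s≤s (ℕ.≤-trans (s≤s z≤n) (ℕ.m≤n+m (suc N) k)))))))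
    (upper N k)
    where m = k ℕ.+ suc N

  shift : ∀ {p q b} → p ≤ q + b → p - q ≤ b
  shift {p} {q} {b} h = begin
    p - q            ≤⟨ +-monoˡ-≤ (- q) h ⟩
    (q + b) - q      ≡⟨ cong (_- q) (+-comm q b) ⟩
    (b + q) - q      ≡⟨ +-assoc b q (- q) ⟩
    b + (q - q)      ≡⟨ cong (λ t → b + t) (+-inverseʳ q) ⟩
    b + 0ℚ           ≡⟨ +-identityʳ b ⟩
    b                ∎
    where open ≤-Reasoning

  neg-- : ∀ p q → - (p - q) ≡ q - p
  neg-- p q = trans (neg-distrib-+ p (- q))
    (trans (cong (λ t → - p + t) (⁻¹-involutive q)) (+-comm (- p) q))
    where open import Algebra.Properties.Group +-0-group using (⁻¹-involutive)

  ∣-∣-bound : ∀ {p q b} → p ≤ q + b → q ≤ p + b → ∣ p - q ∣ ≤ b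
  ∣-∣-bound {p} {q} h₁ h₂ with ∣p∣≡p∨∣p∣≡-p (p - q)
  ... | inj₁ eq = ≤-trans (≤-reflexive eq) (shift h₁)
  ... | inj₂ eq = ≤-trans (≤-reflexive (trans eq (neg-- p q))) (shift h₂)

  within : ∀ N n → suc N ℕ.≤ n →
           partialSum (suc N) ≤ partialSum n × partialSum n ≤ partialSum (suc N) + taylorTerm (suc N)
  within N n N<n = subst
    (λ t → partialSum (suc N) ≤ partialSum t × partialSum t ≤ partialSum (suc N) + taylorTerm (suc N))
    (ℕ.m∸n+n≡m N<n)
    (lower (suc N) k , ≤-trans (p≤p+q _ (taylorTerm-nonNeg (k ℕ.+ suc N))) (upper N k))
    where k = n ℕ.∸ suc N

partialSum-cauchy : ∀ ε → 0ℚ < ε →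
  ∃[ N ] (∀ m n → N ℕ.≤ m → N ℕ.≤ n → ∣ partialSum m - partialSum n ∣ < ε)
partialSum-cauchy ε ε>0 = suc N , λ m n N<m N<n →
  let lₘ , uₘ = within N m N<m
      lₙ , uₙ = within N n N<n
  in ≤-<-trans
       (∣-∣-bound (≤-trans uₘ (+-monoˡ-≤ (taylorTerm (suc N)) lₙ))
                  (≤-trans uₙ (+-monoˡ-≤ (taylorTerm (suc N)) lₘ)))
       (unit-small ε ε>0 (suc N !) {{suc N ℕ.!≢0}} (n≤n! (suc N)))
  where N = ↧ₙ ε

e : ℝ
e = record { approx = partialSum ; cauchy = partialSum-cauchy }

{-# OPTIONS --safe #-}
module Submission where

-- If sₙ is the k-th convergent p/q, then 1/(n+1)! < e - sₙ ≤ 1/(q q′), where q′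
-- is the next denominator, so q² < (n+1)!.  Write sₙ = Aₙ/n! and
-- gₙ = gcd(Aₙ, n!); as n!/gₙ ≤ q, this gives n! < (n+1) gₙ².  The recursion
-- Aₙ₊₁ = (n+1) Aₙ + 1 makes gₙ₊₁ coprime to gₙ and to n+1, while gcd(gₙ, gₙ₊₂)
-- divides n+3, whence gₙ gₙ₊₁ gₙ₊₂ divides (n+3) (n+1)!.  Three consecutive
-- convergents therefore force n! < (n+1)(n+3)³, which fails for n ≥ 8.  For n < 8
-- one of s₂, s₄, s₅, s₇ is among the three; s₄, s₅, s₇ violate n! < (n+1) gₙ², and
-- s₂ = 5/2 is excluded by the stronger q (q+1) < (n+1)!, valid for k ≥ 1.

open import Defs
open import Data.Nat.Base as ℕ using (ℕ; zero; suc; _!)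
import Data.Nat.Properties as ℕ
open import Data.Nat.Divisibility
open import Data.Nat.GCD
  using (gcd; gcd[m,n]∣m; gcd[m,n]∣n; gcd-greatest; c*gcd[m,n]≡gcd[cm,cn]; gcd[m,n]≢0)
open import Data.Nat.LCM using (lcm; gcd*lcm; lcm-least)
open import Data.Nat.Coprimality as Coprimality using (Coprime; coprime-divisor)
open import Data.Nat.Tactic.RingSolver using (solve-∀)
open import Data.Integer.Base as ℤ using (ℤ; +_; +[1+_]; 0ℤ; 1ℤ)
import Data.Integer.Properties as ℤ
import Data.Integer.Tactic.RingSolver as ℤ-Solver
open import Data.Product.Base using (_×_; _,_; ∃-syntax)
open import Data.Rational.Solver using (module +-*-Solver)
open import Data.Rational.Unnormalised.Base as ℚᵘ using (mkℚᵘ; *≤*; *≡*)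
import Data.Rational.Unnormalised.Properties as ℚᵘ
open import Data.Sum.Base using (_⊎_; inj₁; inj₂)
open import Relation.Binary.PropositionalEquality
open import Relation.Nullary.Decidable using (toWitness; toWitnessFalse)
open import Relation.Nullary.Negation.Core using (¬_)

-- Common factors of numerators and factorials

module _ where
  open import Data.Nat.Base using (_+_; _*_; _≤_; _<_; NonZero)
  open import Data.Nat.Properties

  -- numerator n / n! is the n-th partial sum, and cancelled n is the factor by
  -- which this fraction reduces.
  numerator : ℕ → ℕ
  numerator zero    = 1
  numerator (suc n) = suc (suc n * numerator n)

  cancelled : ℕ → ℕ
  cancelled n = gcd (numerator n) (n !)

  coprime-product : ∀ {a b m} → Coprime a b → a ∣ m → b ∣ m → a * b ∣ m
  coprime-product {a} {b} a⊥b (divides x refl) b∣m =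
    subst (_∣ x * a) (*-comm b a) (*-monoˡ-∣ a
      (coprime-divisor (λ (d∣b , d∣a) → a⊥b (d∣a , d∣b)) (subst (b ∣_) (*-comm x a) b∣m)))

  coprime-* : ∀ {a b c} → Coprime a b → Coprime a c → Coprime a (b * c)
  coprime-* {a} {b} a⊥b a⊥c {d} (d∣a , d∣bc) = a⊥c (d∣a , coprime-divisor d⊥b d∣bc)
    where
    d⊥b : Coprime d b
    d⊥b (e∣d , e∣b) = a⊥b (∣-trans e∣d d∣a , e∣b)

  cancelled∣numerator : ∀ n → cancelled n ∣ numerator n
  cancelled∣numerator n = gcd[m,n]∣m (numerator n) (n !)

  cancelled∣n! : ∀ n → cancelled n ∣ n !
  cancelled∣n! n = gcd[m,n]∣n (numerator n) (n !)

  coprime-suc : ∀ m → Coprime (suc m) m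
  coprime-suc m {d} (d∣1+m , d∣m) = ∣1⇒≡1 (∣m+n∣m⇒∣n (subst (d ∣_) (+-comm 1 m) d∣1+m) d∣m)

  coprime-∣ : ∀ {a b c d} → a ∣ c → b ∣ d → Coprime c d → Coprime a b
  coprime-∣ a∣c b∣d c⊥d (e∣a , e∣b) = c⊥d (∣-trans e∣a a∣c , ∣-trans e∣b b∣d)

  -- `numerator (suc n)` is the successor of a multiple of `numerator n`, and consecutive integers
  -- share no factor.
  cancelled-suc⊥cancelled : ∀ n → Coprime (cancelled (suc n)) (cancelled n)
  cancelled-suc⊥cancelled n = coprime-∣ (cancelled∣numerator (suc n))
    (∣-trans (cancelled∣numerator n) (n∣m*n (suc n))) (coprime-suc (suc n * numerator n))

  cancelled-suc∣n! : ∀ n → cancelled (suc n) ∣ n !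
  cancelled-suc∣n! n = coprime-divisor
    (coprime-∣ (cancelled∣numerator (suc n)) (m∣m*n {suc n} (numerator n))
      (coprime-suc (suc n * numerator n)))
    (cancelled∣n! (suc n))

  -- Unrolling the recursion twice gives Aₙ₊₂ = (n+2)(n+1) Aₙ + (n+3).
  gcd-cancelled∣n+3 : ∀ n → gcd (cancelled n) (cancelled (2 + n)) ∣ 3 + n
  gcd-cancelled∣n+3 n = ∣m+n∣m⇒∣n {d} {(2 + n) * (1 + n) * numerator n}
    (subst (d ∣_) (expand n (numerator n))
      (∣-trans (gcd[m,n]∣n (cancelled n) (cancelled (2 + n))) (cancelled∣numerator (2 + n))))
    (∣-trans (∣-trans (gcd[m,n]∣m (cancelled n) (cancelled (2 + n))) (cancelled∣numerator n))
      (n∣m*n ((2 + n) * (1 + n))))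
    where
    d = gcd (cancelled n) (cancelled (2 + n))
    expand : ∀ n a → 1 + (2 + n) * (1 + (1 + n) * a) ≡ (2 + n) * (1 + n) * a + (3 + n)
    expand = solve-∀

  -- The outer two factors may overlap, so their product is split as gcd times lcm. The gcd is
  -- absorbed by n+3; the lcm is coprime to the middle factor, and both divide (n+1)!, so their
  -- product does too.
  cancelled-product∣ : ∀ n →
    cancelled n * cancelled (1 + n) * cancelled (2 + n) ∣ (3 + n) * (1 + n) !
  cancelled-product∣ n = subst (_∣ (3 + n) * (1 + n) !) eq
    (*-pres-∣ (gcd-cancelled∣n+3 n)
      (coprime-product coprime (∣-trans (cancelled-suc∣n! n) n!∣) L∣))
    where
    g₀ = cancelled n
    g₁ = cancelled (1 + n)
    g₂ = cancelled (2 + n)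
    L = lcm g₀ g₂
    n!∣ : n ! ∣ (1 + n) !
    n!∣ = n∣m*n (suc n)
    L∣ : L ∣ (1 + n) !
    L∣ = lcm-least (∣-trans (cancelled∣n! n) n!∣) (cancelled-suc∣n! (suc n))
    L∣product : L ∣ g₀ * g₂
    L∣product = lcm-least (m∣m*n {g₀} g₂) (n∣m*n g₀)
    coprime : Coprime g₁ L
    coprime = coprime-∣ ∣-refl L∣product
      (coprime-* {g₁} {g₀} (cancelled-suc⊥cancelled n)
        (Coprimality.sym (cancelled-suc⊥cancelled (suc n))))
    rearrange : ∀ x y z → x * (y * z) ≡ x * z * y
    rearrange = solve-∀
    rearrange′ : ∀ x y z → x * y * z ≡ x * z * y
    rearrange′ = solve-∀
    eq : gcd g₀ g₂ * (g₁ * L) ≡ g₀ * g₁ * g₂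
    eq = begin
      gcd g₀ g₂ * (g₁ * L)  ≡⟨ rearrange (gcd g₀ g₂) g₁ L ⟩
      gcd g₀ g₂ * L * g₁    ≡⟨ cong (_* g₁) (gcd*lcm g₀ g₂) ⟩
      g₀ * g₂ * g₁          ≡⟨ rearrange′ g₀ g₂ g₁ ⟩
      g₀ * g₁ * g₂          ∎
      where open ≡-Reasoning

  -- With d = n! / cancelled n the reduced denominator, this says d² < (n + 1)!.
  SmallDenominator : ℕ → Set
  SmallDenominator n = n ! < suc n * (cancelled n * cancelled n)

  -- Induction from 8, the first index that works: at 7 the left side is 8000 and 7! is 5040. One
  -- step multiplies the left side by at most 8 and the factorial by 9 + k. To reach 8 instead of
  -- 16, two of the three cubed factors are estimated together, (a+1)² ≤ 2a².
  factorial-bound : ∀ k → (9 + k) * ((11 + k) * (11 + k) * (11 + k)) ≤ (8 + k) !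
  factorial-bound zero    = toWitness {a? = 9 * (11 * 11 * 11) ≤? 8 !} _
  factorial-bound (suc k) = begin
    suc b * (suc a * suc a * suc a)            ≤⟨ *-mono-≤ (suc≤double b) (*-mono-≤ (suc-square≤double (8 + k)) (suc≤double a)) ⟩
    (2 * b) * (2 * (a * a) * (2 * a))          ≡⟨ rearrange a b ⟩
    8 * (b * (a * a * a))                      ≤⟨ *-mono-≤ (m≤n⇒m≤1+n (m≤m+n 8 k)) (factorial-bound k) ⟩
    b * (8 + k) !                              ∎
    where
    open ≤-Reasoning
    a = 11 + k
    b = 9 + k
    suc≤double : ∀ m .{{_ : NonZero m}} → suc m ≤ 2 * m
    suc≤double m = ≤-trans (≤-reflexive (+-comm 1 m))
      (+-monoʳ-≤ m (≤-trans (ℕ.>-nonZero⁻¹ m) (m≤m+n m 0)))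
    suc-square≤double : ∀ m → (4 + m) * (4 + m) ≤ 2 * ((3 + m) * (3 + m))
    suc-square≤double m = subst ((4 + m) * (4 + m) ≤_) (expand m) (m≤m+n _ _)
      where
      expand : ∀ m → (4 + m) * (4 + m) + (2 + m * (4 + m)) ≡ 2 * ((3 + m) * (3 + m))
      expand = solve-∀
    rearrange : ∀ a b → (2 * b) * (2 * (a * a) * (2 * a)) ≡ 8 * (b * (a * a * a))
    rearrange = solve-∀

  -- The product of the three hypotheses bounds n! (n+1)! (n+2)! by (n+1)(n+2)(n+3) times the square
  -- of g₀ g₁ g₂. That product is at most (n+3)(n+1)!, and (n+2) (n+1)!² cancels from both sides.
  three-small⇒n!< : ∀ n → SmallDenominator n → SmallDenominator (1 + n) → SmallDenominator (2 + n) →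
    n ! < (1 + n) * ((3 + n) * (3 + n) * (3 + n))
  three-small⇒n!< n h₀ h₁ h₂ = *-cancelʳ-< ((2 + n) * (f * f)) (n !) _ (begin-strict
    n ! * ((2 + n) * (f * f))          ≡⟨ r₁ (n !) (2 + n) f ⟩
    n ! * f * ((2 + n) * f)            <⟨ *-mono-< (*-mono-< h₀ h₁) h₂ ⟩
    (1 + n) * (g₀ * g₀) * ((2 + n) * (g₁ * g₁)) * ((3 + n) * (g₂ * g₂))
      ≡⟨ r₂ (1 + n) (2 + n) (3 + n) g₀ g₁ g₂ ⟩
    (1 + n) * (2 + n) * (3 + n) * (g₀ * g₁ * g₂ * (g₀ * g₁ * g₂))
      ≤⟨ *-monoʳ-≤ ((1 + n) * (2 + n) * (3 + n)) (*-mono-≤ product≤ product≤) ⟩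
    (1 + n) * (2 + n) * (3 + n) * ((3 + n) * f * ((3 + n) * f))
      ≡⟨ r₃ (1 + n) (2 + n) (3 + n) f ⟩
    (1 + n) * ((3 + n) * (3 + n) * (3 + n)) * ((2 + n) * (f * f)) ∎)
    where
    open ≤-Reasoning
    f = (1 + n) !
    g₀ = cancelled n
    g₁ = cancelled (1 + n)
    g₂ = cancelled (2 + n)
    product≤ : g₀ * g₁ * g₂ ≤ (3 + n) * f
    product≤ = ∣⇒≤ {{m*n≢0 (3 + n) f {{_}} {{(1 + n) !≢0}}}} (cancelled-product∣ n)
    r₁ : ∀ x a f → x * (a * (f * f)) ≡ x * f * (a * f)
    r₁ = solve-∀
    r₂ : ∀ a b c x y z → a * (x * x) * (b * (y * y)) * (c * (z * z)) ≡ a * b * c * (x * y * z * (x * y * z))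
    r₂ = solve-∀
    r₃ : ∀ a b c f → a * b * c * (c * f * (c * f)) ≡ a * (c * c * c) * (b * (f * f))
    r₃ = solve-∀

  -- As n! divides both q Aₙ and q n!, it divides their gcd q gₙ, so n! ≤ q gₙ. Squaring and
  -- inserting q² < (n+1) n! leaves one n! to cancel.
  smallDenominator : ∀ n q → n ! ∣ q * numerator n → .{{NonZero q}} → q * q < (suc n) ! → SmallDenominator n
  smallDenominator n q n!∣q*numerator q²< = *-cancelʳ-< (n !) (n !) _ (begin-strict
    n ! * n !              ≤⟨ *-mono-≤ n!≤q*g n!≤q*g ⟩
    q * g * (q * g)        ≡⟨ r₁ q g ⟩
    q * q * (g * g)        <⟨ *-monoˡ-< (g * g) {{m*n≢0 g g}} q²< ⟩
    suc n * n ! * (g * g)  ≡⟨ r₂ (suc n) (n !) g ⟩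
    suc n * (g * g) * n !  ∎)
    where
    open ≤-Reasoning
    g = cancelled n
    instance
      n!≢0 : NonZero (n !)
      n!≢0 = n !≢0
      g≢0 : NonZero g
      g≢0 = ℕ.≢-nonZero (gcd[m,n]≢0 (numerator n) (n !) (inj₂ (ℕ.≢-nonZero⁻¹ (n !))))
    n!≤q*g : n ! ≤ q * g
    n!≤q*g = ∣⇒≤ {{m*n≢0 q g}} (subst (n ! ∣_)
      (sym (c*gcd[m,n]≡gcd[cm,cn] q (numerator n) (n !)))
      (gcd-greatest n!∣q*numerator (n∣m*n q)))
    r₁ : ∀ q g → q * g * (q * g) ≡ q * q * (g * g)
    r₁ = solve-∀
    r₂ : ∀ s x g → s * x * (g * g) ≡ s * (g * g) * x
    r₂ = solve-∀

-- Numerators and denominators of truncated continued fractions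

-- The classical continuants, computed from the front to match `truncation`: if the tail truncates
-- to p/q, then a₀ + q/p = (a₀ p + q)/p.
num den : SimpleCF → ℕ → ℤ
num c zero    = quotient c 0
num c (suc k) = quotient c 0 ℤ.* num (tail c) k ℤ.+ den (tail c) k
den c zero    = 1ℤ
den c (suc k) = num (tail c) k

drop : ℕ → SimpleCF → SimpleCF
drop zero    c = c
drop (suc k) c = drop k (tail c)

module _ where
  open import Data.Integer.Base using (_*_; _+_; _≤_; _<_)
  open ℤ.≤-Reasoning

  mutual
    num-pos : ∀ c k → ℤ.Positive (quotient c 0) → 0ℤ < num c k
    num-pos c zero    a>0 = ℤ.positive⁻¹ _ {{a>0}}
    num-pos c (suc k) a>0 = begin-strict
      0ℤ                                                ≡⟨ ℤ.*-zeroʳ (quotient c 0) ⟨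
      quotient c 0 * 0ℤ                                 <⟨ ℤ.*-monoˡ-<-pos (quotient c 0) {{a>0}} (num-pos (tail c) k (quotient>0 c 0)) ⟩
      quotient c 0 * num (tail c) k                     ≡⟨ ℤ.+-identityʳ _ ⟨
      quotient c 0 * num (tail c) k + 0ℤ                ≤⟨ ℤ.+-monoʳ-≤ (quotient c 0 * num (tail c) k) (ℤ.<⇒≤ (den-pos (tail c) k)) ⟩
      quotient c 0 * num (tail c) k + den (tail c) k    ∎

    den-pos : ∀ c k → 0ℤ < den c k
    den-pos c zero    = ℤ.positive⁻¹ 1ℤ
    den-pos c (suc k) = num-pos (tail c) k (quotient>0 c 0)

  i≤a*i : ∀ {a i} → ℤ.Positive a → 0ℤ ≤ i → i ≤ a * i
  i≤a*i {a} {i} a>0 i≥0 = begin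
    i       ≡⟨ ℤ.*-identityˡ i ⟨
    1ℤ * i  ≤⟨ ℤ.*-monoʳ-≤-nonNeg i {{ℤ.nonNegative i≥0}} (ℤ.i<j⇒suc[i]≤j (ℤ.positive⁻¹ a {{a>0}})) ⟩
    a * i   ∎

  den≤num : ∀ c k → ℤ.Positive (quotient c 0) → den c k ≤ num c k
  den≤num c zero    a>0 = ℤ.i<j⇒suc[i]≤j (ℤ.positive⁻¹ (quotient c 0) {{a>0}})
  den≤num c (suc k) a>0 = begin
    num (tail c) k                                  ≤⟨ i≤a*i a>0 (ℤ.<⇒≤ (den-pos c (suc k))) ⟩
    quotient c 0 * num (tail c) k                   ≡⟨ ℤ.+-identityʳ _ ⟨
    quotient c 0 * num (tail c) k + 0ℤ              ≤⟨ ℤ.+-monoʳ-≤ (quotient c 0 * num (tail c) k) (ℤ.<⇒≤ (den-pos (tail c) k)) ⟩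
    quotient c 0 * num (tail c) k + den (tail c) k  ∎

  -- Both bounds reflect den (suc (k + j)) = den k * num y + den (k - 1) * den y for the
  -- complete quotient y = drop (suc k) c truncated at j, where num y ≥ den y.
  mutual
    num-growth : ∀ c k j → ℤ.Positive (quotient c 0) →
      (num c k + 1ℤ) * den (drop (suc k) c) j ≤ num c (suc (k ℕ.+ j))
    num-growth c zero j a>0 = begin
      (quotient c 0 + 1ℤ) * d                          ≡⟨ lemma (quotient c 0) d ⟩
      quotient c 0 * d + d
        ≤⟨ ℤ.+-monoˡ-≤ d (ℤ.*-monoˡ-≤-nonNeg (quotient c 0) {{ℤ.nonNegative (ℤ.<⇒≤ (ℤ.positive⁻¹ _ {{a>0}}))}} (den≤num (tail c) j (quotient>0 c 0))) ⟩
      quotient c 0 * num (tail c) j + d                ∎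
      where
      d = den (tail c) j
      lemma : ∀ a d → (a + 1ℤ) * d ≡ a * d + d
      lemma = ℤ-Solver.solve-∀
    num-growth c (suc k) j a>0 = begin
      -- The `+ 1ℤ` contributes one extra `d`. The induction hypothesis supplies `a * d`, which
      -- covers it because `a` is at least 1.
      (a * p + q + 1ℤ) * d         ≡⟨ lemma₁ a p q d ⟩
      a * (p * d) + q * d + d      ≤⟨ ℤ.+-monoʳ-≤ (a * (p * d) + q * d) (i≤a*i a>0 (ℤ.<⇒≤ (den-pos (drop (suc k) (tail c)) j))) ⟩
      a * (p * d) + q * d + a * d  ≡⟨ lemma₂ a p q d ⟩
      a * ((p + 1ℤ) * d) + q * d
        ≤⟨ ℤ.+-mono-≤ (ℤ.*-monoˡ-≤-nonNeg a {{ℤ.nonNegative (ℤ.<⇒≤ (ℤ.positive⁻¹ _ {{a>0}}))}} (num-growth (tail c) k j (quotient>0 c 0)))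
             (den-growth (tail c) k j) ⟩
      a * num (tail c) (suc (k ℕ.+ j)) + den (tail c) (suc (k ℕ.+ j)) ∎
      where
      a = quotient c 0
      p = num (tail c) k
      q = den (tail c) k
      d = den (drop (suc k) (tail c)) j
      lemma₁ : ∀ a p q d → (a * p + q + 1ℤ) * d ≡ a * (p * d) + q * d + d
      lemma₁ = ℤ-Solver.solve-∀
      lemma₂ : ∀ a p q d → a * (p * d) + q * d + a * d ≡ a * ((p + 1ℤ) * d) + q * d
      lemma₂ = ℤ-Solver.solve-∀

    den-growth : ∀ c k j → den c k * den (drop (suc k) c) j ≤ den c (suc (k ℕ.+ j))
    den-growth c zero j = begin
      1ℤ * den (tail c) j  ≡⟨ ℤ.*-identityˡ _ ⟩
      den (tail c) j       ≤⟨ den≤num (tail c) j (quotient>0 c 0) ⟩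
      num (tail c) j       ∎
    den-growth c (suc k) j = begin
      num (tail c) k * d           ≤⟨ ℤ.*-monoʳ-≤-nonNeg d {{ℤ.nonNegative (ℤ.<⇒≤ (den-pos (drop (suc k) (tail c)) j))}} (ℤ.i≤i+j (num (tail c) k) 1ℤ) ⟩
      (num (tail c) k + 1ℤ) * d    ≤⟨ num-growth (tail c) k j (quotient>0 c 0) ⟩
      num (tail c) (suc (k ℕ.+ j)) ∎
      where d = den (drop (suc k) (tail c)) j

  -- Prepending a quotient a applies the matrix with rows (a, 1) and (1, 0), of determinant -1, so
  -- only the sign changes; the absolute value removes it. For j = 0 this is the classical identity
  -- with value 1. General j is needed to compare a convergent with arbitrarily late ones.
  determinant : ∀ c k j →
    ℤ.∣ num c (suc (k ℕ.+ j)) * den c k ℤ.- num c k * den c (suc (k ℕ.+ j)) ∣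
      ≡ ℤ.∣ den (drop (suc k) c) j ∣
  determinant c zero j =
    cong ℤ.∣_∣ (lemma (quotient c 0) (num (tail c) j) (den (tail c) j))
    where
    lemma : ∀ a p q → (a * p + q) * 1ℤ ℤ.- a * p ≡ q
    lemma = ℤ-Solver.solve-∀
  determinant c (suc k) j = trans
    (cong ℤ.∣_∣ (lemma (quotient c 0) (num (tail c) m) (den (tail c) m) (num (tail c) k) (den (tail c) k)))
    (trans (ℤ.∣-i∣≡∣i∣ (num (tail c) m * den (tail c) k ℤ.- num (tail c) k * den (tail c) m))
           (determinant (tail c) k j))
    where
    m = suc (k ℕ.+ j)
    lemma : ∀ a p q p′ q′ →
      (a * p + q) * p′ ℤ.- (a * p′ + q′) * p ≡ ℤ.- (p * q′ ℤ.- p′ * q)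
    lemma = ℤ-Solver.solve-∀

+∣den∣ : ∀ c k → + ℤ.∣ den c k ∣ ≡ den c k
+∣den∣ c k = ℤ.0≤i⇒+∣i∣≡i (ℤ.<⇒≤ (den-pos c k))

-- Distance from a convergent to e

module _ where
  open import Data.Rational.Base
  open import Data.Rational.Properties

  fromℤ : ℤ → ℚ
  fromℤ i = i / 1

  toℚᵘ-fromℤ : ∀ i → toℚᵘ (fromℤ i) ℚᵘ.≃ mkℚᵘ i 0
  toℚᵘ-fromℤ i = toℚᵘ-fromℚᵘ (mkℚᵘ i 0)

  fromℤ-+ : ∀ i j → fromℤ (i ℤ.+ j) ≡ fromℤ i + fromℤ j
  fromℤ-+ i j = toℚᵘ-injective (begin
    toℚᵘ (fromℤ (i ℤ.+ j))                    ≈⟨ toℚᵘ-fromℤ (i ℤ.+ j) ⟩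
    mkℚᵘ (i ℤ.+ j) 0                          ≈⟨ *≡* (lemma i j) ⟩
    mkℚᵘ i 0 ℚᵘ.+ mkℚᵘ j 0                    ≈⟨ ℚᵘ.+-cong (toℚᵘ-fromℤ i) (toℚᵘ-fromℤ j) ⟨
    toℚᵘ (fromℤ i) ℚᵘ.+ toℚᵘ (fromℤ j)        ≈⟨ toℚᵘ-homo-+ (fromℤ i) (fromℤ j) ⟨
    toℚᵘ (fromℤ i + fromℤ j)                  ∎)
    where
    open ℚᵘ.≃-Reasoning
    lemma : ∀ i j → (i ℤ.+ j) ℤ.* 1ℤ ≡ (i ℤ.* 1ℤ ℤ.+ j ℤ.* 1ℤ) ℤ.* 1ℤ
    lemma = ℤ-Solver.solve-∀

  fromℤ-* : ∀ i j → fromℤ (i ℤ.* j) ≡ fromℤ i * fromℤ j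
  fromℤ-* i j = toℚᵘ-injective (begin
    toℚᵘ (fromℤ (i ℤ.* j))                    ≈⟨ toℚᵘ-fromℤ (i ℤ.* j) ⟩
    mkℚᵘ i 0 ℚᵘ.* mkℚᵘ j 0                    ≈⟨ ℚᵘ.*-cong (toℚᵘ-fromℤ i) (toℚᵘ-fromℤ j) ⟨
    toℚᵘ (fromℤ i) ℚᵘ.* toℚᵘ (fromℤ j)        ≈⟨ toℚᵘ-homo-* (fromℤ i) (fromℤ j) ⟨
    toℚᵘ (fromℤ i * fromℤ j)                  ∎)
    where open ℚᵘ.≃-Reasoning

  fromℤ-neg : ∀ i → fromℤ (ℤ.- i) ≡ - fromℤ i
  fromℤ-neg i = toℚᵘ-injective (begin
    toℚᵘ (fromℤ (ℤ.- i))   ≈⟨ toℚᵘ-fromℤ (ℤ.- i) ⟩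
    ℚᵘ.- mkℚᵘ i 0          ≈⟨ ℚᵘ.-‿cong (toℚᵘ-fromℤ i) ⟨
    ℚᵘ.- toℚᵘ (fromℤ i)    ≈⟨ toℚᵘ-homo‿- (fromℤ i) ⟨
    toℚᵘ (- fromℤ i)       ∎)
    where open ℚᵘ.≃-Reasoning

  fromℤ-∣∣ : ∀ i → ∣ fromℤ i ∣ ≡ fromℤ (+ ℤ.∣ i ∣)
  fromℤ-∣∣ i = toℚᵘ-injective (begin
    toℚᵘ ∣ fromℤ i ∣         ≈⟨ toℚᵘ-homo-∣-∣ (fromℤ i) ⟩
    ℚᵘ.∣ toℚᵘ (fromℤ i) ∣    ≈⟨ ℚᵘ.∣-∣-cong (toℚᵘ-fromℤ i) ⟩
    ℚᵘ.∣ mkℚᵘ i 0 ∣          ≈⟨ toℚᵘ-fromℤ (+ ℤ.∣ i ∣) ⟨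
    toℚᵘ (fromℤ (+ ℤ.∣ i ∣)) ∎)
    where open ℚᵘ.≃-Reasoning

  fromℤ-mono-≤ : ∀ {i j} → i ℤ.≤ j → fromℤ i ≤ fromℤ j
  fromℤ-mono-≤ {i} {j} i≤j = toℚᵘ-cancel-≤ (begin
    toℚᵘ (fromℤ i)  ≃⟨ toℚᵘ-fromℤ i ⟩
    mkℚᵘ i 0        ≤⟨ *≤* (ℤ.*-monoʳ-≤-nonNeg 1ℤ i≤j) ⟩
    mkℚᵘ j 0        ≃⟨ toℚᵘ-fromℤ j ⟨
    toℚᵘ (fromℤ j)  ∎)
    where open ℚᵘ.≤-Reasoning

  fromℤ-cancel-< : ∀ {i j} → fromℤ i < fromℤ j → i ℤ.< j
  fromℤ-cancel-< i<j = ℤ.≰⇒> (λ j≤i → <-irrefl refl (<-≤-trans i<j (fromℤ-mono-≤ j≤i)))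

  fromℤ-injective : ∀ {i j} → fromℤ i ≡ fromℤ j → i ≡ j
  fromℤ-injective {i} {j} eq = ℤ.≤-antisym (half (≤-reflexive eq)) (half (≤-reflexive (sym eq)))
    where
    half : ∀ {i j} → fromℤ i ≤ fromℤ j → i ℤ.≤ j
    half {i} {j} i≤j = subst₂ ℤ._≤_ (ℤ.*-identityʳ i) (ℤ.*-identityʳ j)
      (ℚᵘ.drop-*≤* (ℚᵘ.≤-respʳ-≃ (toℚᵘ-fromℤ j) (ℚᵘ.≤-respˡ-≃ (toℚᵘ-fromℤ i) (toℚᵘ-mono-≤ i≤j))))

  fromℤ-nonNeg : ∀ {i} → 0ℤ ℤ.≤ i → NonNegative (fromℤ i)
  fromℤ-nonNeg i≥0 = nonNegative (fromℤ-mono-≤ i≥0)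

  fromℤ-pos : ∀ {i} → 0ℤ ℤ.< i → Positive (fromℤ i)
  fromℤ-pos {+[1+ n ]} _ = n/1-pos +[1+ n ] _
  fromℤ-pos {+ 0} (ℤ.+<+ ())

  truncation-* : ∀ c k → truncation c k * fromℤ (den c k) ≡ fromℤ (num c k)
  truncation-* c zero    = *-identityʳ (fromℤ (quotient c 0))
  truncation-* c (suc k) = begin
    (a + 1/T) * fromℤ p                 ≡⟨ *-distribʳ-+ (fromℤ p) a 1/T ⟩
    a * fromℤ p + 1/T * fromℤ p         ≡⟨ cong₂ _+_ (sym (fromℤ-* (quotient c 0) p)) cancel ⟩
    fromℤ (quotient c 0 ℤ.* p) + fromℤ q ≡⟨ fromℤ-+ (quotient c 0 ℤ.* p) q ⟨
    fromℤ (quotient c 0 ℤ.* p ℤ.+ q)    ∎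
    where
    open ≡-Reasoning
    a = fromℤ (quotient c 0)
    T = truncation (tail c) k
    1/T = (1/ T) {{truncation-tail≢0 c k}}
    p = num (tail c) k
    q = den (tail c) k
    cancel : 1/T * fromℤ p ≡ fromℤ q
    cancel = begin
      1/T * fromℤ p        ≡⟨ cong (1/T *_) (truncation-* (tail c) k) ⟨
      1/T * (T * fromℤ q)  ≡⟨ *-assoc 1/T T (fromℤ q) ⟨
      1/T * T * fromℤ q    ≡⟨ cong (_* fromℤ q) (*-inverseˡ T {{truncation-tail≢0 c k}}) ⟩
      1ℚ * fromℤ q         ≡⟨ *-identityˡ (fromℤ q) ⟩
      fromℤ q              ∎

  -- By `determinant` the distance is d/(D q), with d the denominator of the truncated complete
  -- quotient. The hypothesis w d ≤ D turns this into 1/(q w), uniformly in j; w stands for a lower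
  -- bound on the next denominator.
  truncation-distance : ∀ c k j w → + w ℤ.* den (drop (suc k) c) j ℤ.≤ den c (suc (k ℕ.+ j)) →
    ∣ truncation c (suc (k ℕ.+ j)) - truncation c k ∣ * fromℤ (den c k ℤ.* + w) ≤ 1ℚ
  truncation-distance c k j w w*d≤den =
    *-cancelʳ-≤-pos (fromℤ D) {{fromℤ-pos (den-pos c m)}} (begin
    ∣ t - s ∣ * fromℤ (q ℤ.* + w) * fromℤ D
      ≡⟨ cong (λ z → ∣ t - s ∣ * z * fromℤ D) (fromℤ-* q (+ w)) ⟩
    ∣ t - s ∣ * (fromℤ q * fromℤ (+ w)) * fromℤ D
      ≡⟨ rearrange ∣ t - s ∣ (fromℤ q) (fromℤ (+ w)) (fromℤ D) ⟩
    fromℤ (+ w) * (∣ t - s ∣ * (fromℤ D * fromℤ q))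
      ≡⟨ cong (λ z → fromℤ (+ w) * (∣ t - s ∣ * z)) (sym (trans (0≤p⇒∣p∣≡p D*q≥0) (fromℤ-* D q))) ⟩
    fromℤ (+ w) * (∣ t - s ∣ * ∣ fromℤ (D ℤ.* q) ∣)
      ≡⟨ cong (fromℤ (+ w) *_) (sym (∣p*q∣≡∣p∣*∣q∣ (t - s) (fromℤ (D ℤ.* q)))) ⟩
    fromℤ (+ w) * ∣ (t - s) * fromℤ (D ℤ.* q) ∣
      ≡⟨ cong (λ z → fromℤ (+ w) * ∣ z ∣) difference ⟩
    fromℤ (+ w) * ∣ fromℤ (P ℤ.* q ℤ.- p ℤ.* D) ∣
      ≡⟨ cong (fromℤ (+ w) *_) (fromℤ-∣∣ (P ℤ.* q ℤ.- p ℤ.* D)) ⟩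
    fromℤ (+ w) * fromℤ (+ ℤ.∣ P ℤ.* q ℤ.- p ℤ.* D ∣)
      ≡⟨ cong (λ z → fromℤ (+ w) * fromℤ (+ z)) (determinant c k j) ⟩
    fromℤ (+ w) * fromℤ (+ ℤ.∣ d ∣)
      ≡⟨ cong (λ z → fromℤ (+ w) * fromℤ z) (ℤ.0≤i⇒+∣i∣≡i (ℤ.<⇒≤ (den-pos (drop (suc k) c) j))) ⟩
    fromℤ (+ w) * fromℤ d   ≡⟨ fromℤ-* (+ w) d ⟨
    fromℤ (+ w ℤ.* d)       ≤⟨ fromℤ-mono-≤ w*d≤den ⟩
    fromℤ D                 ≡⟨ *-identityˡ (fromℤ D) ⟨
    1ℚ * fromℤ D            ∎)
    where
    open ≤-Reasoning
    m = suc (k ℕ.+ j)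
    t = truncation c m
    s = truncation c k
    P = num c m
    D = den c m
    p = num c k
    q = den c k
    d = den (drop (suc k) c) j
    D*q≥0 : 0ℚ ≤ fromℤ (D ℤ.* q)
    D*q≥0 = subst (0ℚ ≤_) (sym (fromℤ-* D q)) (nonNegative⁻¹ _
      {{nonNeg*nonNeg⇒nonNeg (fromℤ D) {{fromℤ-nonNeg (ℤ.<⇒≤ (den-pos c m))}}
                             (fromℤ q) {{fromℤ-nonNeg (ℤ.<⇒≤ (den-pos c k))}}}})
    rearrange : ∀ x y z u → x * (y * z) * u ≡ z * (x * (u * y))
    rearrange = solve 4 (λ x y z u → (x :* (y :* z)) :* u := z :* (x :* (u :* y))) refl
      where open +-*-Solver
    expand : ∀ t s D q → (t - s) * (D * q) ≡ (t * D) * q - (s * q) * D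
    expand = solve 4 (λ t s D q → (t :- s) :* (D :* q) := (t :* D) :* q :- (s :* q) :* D) refl
      where open +-*-Solver
    difference : (t - s) * fromℤ (D ℤ.* q) ≡ fromℤ (P ℤ.* q ℤ.- p ℤ.* D)
    difference = begin-equality
      (t - s) * fromℤ (D ℤ.* q)                       ≡⟨ cong ((t - s) *_) (fromℤ-* D q) ⟩
      (t - s) * (fromℤ D * fromℤ q)                   ≡⟨ expand t s (fromℤ D) (fromℤ q) ⟩
      t * fromℤ D * fromℤ q - s * fromℤ q * fromℤ D
        ≡⟨ cong₂ (λ x y → x * fromℤ q - y * fromℤ D) (truncation-* c m) (truncation-* c k) ⟩
      fromℤ P * fromℤ q - fromℤ p * fromℤ D
        ≡⟨ cong₂ _-_ (fromℤ-* P q) (fromℤ-* p D) ⟨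
      fromℤ (P ℤ.* q) - fromℤ (p ℤ.* D)
        ≡⟨ cong (λ z → fromℤ (P ℤ.* q) + z) (fromℤ-neg (p ℤ.* D)) ⟨
      fromℤ (P ℤ.* q) + fromℤ (ℤ.- (p ℤ.* D))
        ≡⟨ fromℤ-+ (P ℤ.* q) (ℤ.- (p ℤ.* D)) ⟨
      fromℤ (P ℤ.* q ℤ.- p ℤ.* D) ∎

  -- Partial sums over factorial denominators

  1/-*-inverse : ∀ d .{{_ : ℕ.NonZero d}} → + 1 / d * fromℤ (+ d) ≡ 1ℚ
  1/-*-inverse (suc d) = toℚᵘ-injective (begin
    toℚᵘ (+ 1 / suc d * fromℤ +[1+ d ])               ≈⟨ toℚᵘ-homo-* (+ 1 / suc d) (fromℤ +[1+ d ]) ⟩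
    toℚᵘ (+ 1 / suc d) ℚᵘ.* toℚᵘ (fromℤ +[1+ d ])     ≈⟨ ℚᵘ.*-cong (toℚᵘ-fromℚᵘ (mkℚᵘ (+ 1) d)) (toℚᵘ-fromℤ +[1+ d ]) ⟩
    mkℚᵘ (+ 1) d ℚᵘ.* mkℚᵘ +[1+ d ] 0                 ≈⟨ ℚᵘ.*-inverseˡ (mkℚᵘ +[1+ d ] 0) ⟩
    toℚᵘ 1ℚ                                           ∎)
    where open ℚᵘ.≃-Reasoning

  taylorTerm-* : ∀ n → taylorTerm n * fromℤ (+ (n !)) ≡ 1ℚ
  taylorTerm-* n = 1/-*-inverse (n !) {{n ℕ.!≢0}}

  taylorTerm-pos : ∀ n → Positive (taylorTerm n)
  taylorTerm-pos n = normalize-pos 1 (n !) {{n ℕ.!≢0}}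

  partialSum-* : ∀ n → partialSum n * fromℤ (+ (n !)) ≡ fromℤ (+ numerator n)
  partialSum-* zero    = refl
  partialSum-* (suc n) = begin
    (partialSum n + t) * fromℤ (+ (suc n !))                   ≡⟨ *-distribʳ-+ (fromℤ (+ (suc n !))) (partialSum n) t ⟩
    partialSum n * fromℤ (+ (suc n !)) + t * fromℤ (+ (suc n !))
      ≡⟨ cong₂ _+_ head (taylorTerm-* (suc n)) ⟩
    fromℤ (+ (suc n ℕ.* numerator n)) + 1ℚ                              ≡⟨ +-comm (fromℤ (+ (suc n ℕ.* numerator n))) 1ℚ ⟩
    1ℚ + fromℤ (+ (suc n ℕ.* numerator n))                              ≡⟨ fromℤ-+ 1ℤ (+ (suc n ℕ.* numerator n)) ⟨
    fromℤ (+ numerator (suc n))                                         ∎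
    where
    open ≡-Reasoning
    t = taylorTerm (suc n)
    fromℕ-* : ∀ a b → fromℤ (+ (a ℕ.* b)) ≡ fromℤ (+ a) * fromℤ (+ b)
    fromℕ-* a b = trans (cong fromℤ (ℤ.pos-* a b)) (fromℤ-* (+ a) (+ b))
    exchange : ∀ x y z → x * (y * z) ≡ y * (x * z)
    exchange = solve 3 (λ x y z → x :* (y :* z) := y :* (x :* z)) refl
      where open +-*-Solver
    head : partialSum n * fromℤ (+ (suc n !)) ≡ fromℤ (+ (suc n ℕ.* numerator n))
    head = begin
      partialSum n * fromℤ (+ (suc n ℕ.* n !))             ≡⟨ cong (partialSum n *_) (fromℕ-* (suc n) (n !)) ⟩
      partialSum n * (fromℤ (+ suc n) * fromℤ (+ (n !)))   ≡⟨ exchange (partialSum n) (fromℤ (+ suc n)) (fromℤ (+ (n !))) ⟩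
      fromℤ (+ suc n) * (partialSum n * fromℤ (+ (n !)))   ≡⟨ cong (fromℤ (+ suc n) *_) (partialSum-* n) ⟩
      fromℤ (+ suc n) * fromℤ (+ numerator n)                      ≡⟨ fromℕ-* (suc n) (numerator n) ⟨
      fromℤ (+ (suc n ℕ.* numerator n))                            ∎

  partialSum-mono : ∀ {m n} → m ℕ.≤ n → partialSum m ≤ partialSum n
  partialSum-mono {m} {n} m≤n = subst (λ z → partialSum m ≤ partialSum z) (ℕ.m∸n+n≡m m≤n) (go (n ℕ.∸ m))
    where
    go : ∀ k → partialSum m ≤ partialSum (k ℕ.+ m)
    go zero    = ≤-refl
    go (suc k) = ≤-trans (go k) (subst (_≤ partialSum (suc k ℕ.+ m)) (+-identityʳ _)
      (+-monoʳ-≤ (partialSum (k ℕ.+ m)) (<⇒≤ (positive⁻¹ _ {{taylorTerm-pos (suc k ℕ.+ m)}}))))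

  p≤∣p∣ : ∀ p → p ≤ ∣ p ∣
  p≤∣p∣ p with ≤-total 0ℚ p
  ... | inj₁ 0≤p = ≤-reflexive (sym (0≤p⇒∣p∣≡p 0≤p))
  ... | inj₂ p≤0 = ≤-trans p≤0 (nonNegative⁻¹ ∣ p ∣ {{∣-∣-nonNeg p}})

  -- The distance from sₙ to a limit of the partial sums exceeds the next term;
  -- here t merely has to be close to a later partial sum.
  taylorTerm<distance : ∀ n m t → 2 ℕ.+ n ℕ.≤ m → ∣ t - partialSum m ∣ < taylorTerm (2 ℕ.+ n) →
    taylorTerm (suc n) < ∣ t - partialSum n ∣
  taylorTerm<distance n m t n+2≤m near = begin-strict
    u                              ≡⟨ rearrange₁ s u v t ⟩
    -- `s + u + v` is the partial sum of index n+2, hence at most `partialSum m`, so it exceeds `t`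
    -- by less than `v`. This leaves `t - s` larger than `u`.
    (s + u + v - t) + (t - s) - v  <⟨ +-mono-<-≤ (+-monoˡ-< (t - s) upper) (≤-refl {x = - v}) ⟩
    v + (t - s) - v                ≡⟨ rearrange₂ v (t - s) ⟩
    t - s                          ≤⟨ p≤∣p∣ (t - s) ⟩
    ∣ t - s ∣                      ∎
    where
    open ≤-Reasoning
    s = partialSum n
    u = taylorTerm (suc n)
    v = taylorTerm (2 ℕ.+ n)
    negate : ∀ x y → - (x - y) ≡ y - x
    negate = solve 2 (λ x y → :- (x :- y) := y :- x) refl
      where open +-*-Solver
    upper : s + u + v - t < v
    upper = begin-strict
      s + u + v - t           ≤⟨ +-monoˡ-≤ (- t) (partialSum-mono n+2≤m) ⟩
      partialSum m - t        ≤⟨ p≤∣p∣ (partialSum m - t) ⟩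
      ∣ partialSum m - t ∣    ≡⟨ trans (cong ∣_∣ (sym (negate t (partialSum m)))) (∣-p∣≡∣p∣ (t - partialSum m)) ⟩
      ∣ t - partialSum m ∣    <⟨ near ⟩
      v                       ∎
    rearrange₁ : ∀ s u v t → u ≡ (s + u + v - t) + (t - s) - v
    rearrange₁ = solve 4 (λ s u v t → u := (s :+ u :+ v :- t) :+ (t :- s) :- v) refl
      where open +-*-Solver
    rearrange₂ : ∀ x y → x + y - x ≡ y
    rearrange₂ = solve 2 (λ x y → x :+ y :- x := y) refl
      where open +-*-Solver

  -- Denominators of convergents that equal partial sums

  module _ (n : ℕ) (c : SimpleCF) (k : ℕ) (c-e : IsExpansionOf c e) (sₙ≡ : partialSum n ≡ truncation c k) where

    -- Cross-multiplication of p/q = Aₙ/n!, with p as the cofactor.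
    n!∣den*numerator : n ! ∣ ℤ.∣ den c k ∣ ℕ.* numerator n
    n!∣den*numerator = divides ℤ.∣ num c k ∣ (trans (sym (ℤ.abs-* (den c k) (+ numerator n)))
      (trans (cong ℤ.∣_∣ (fromℤ-injective {den c k ℤ.* + numerator n} {num c k ℤ.* + (n !)} eq)) (ℤ.abs-* (num c k) (+ (n !)))))
      where
      open ≡-Reasoning
      exchange : ∀ x y z → x * (y * z) ≡ y * x * z
      exchange = solve 3 (λ x y z → x :* (y :* z) := y :* x :* z) refl
        where open +-*-Solver
      eq : fromℤ (den c k ℤ.* + numerator n) ≡ fromℤ (num c k ℤ.* + (n !))
      eq = begin
        fromℤ (den c k ℤ.* + numerator n)                          ≡⟨ fromℤ-* (den c k) (+ numerator n) ⟩
        fromℤ (den c k) * fromℤ (+ numerator n)                    ≡⟨ cong (fromℤ (den c k) *_) (partialSum-* n) ⟨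
        fromℤ (den c k) * (partialSum n * fromℤ (+ (n !))) ≡⟨ exchange (fromℤ (den c k)) (partialSum n) (fromℤ (+ (n !))) ⟩
        partialSum n * fromℤ (den c k) * fromℤ (+ (n !))   ≡⟨ cong (λ z → z * fromℤ (den c k) * fromℤ (+ (n !))) sₙ≡ ⟩
        truncation c k * fromℤ (den c k) * fromℤ (+ (n !)) ≡⟨ cong (_* fromℤ (+ (n !))) (truncation-* c k) ⟩
        fromℤ (num c k) * fromℤ (+ (n !))                  ≡⟨ fromℤ-* (num c k) (+ (n !)) ⟨
        fromℤ (num c k ℤ.* + (n !))                        ∎

    -- A late truncation t stands in for the limit: 1/(n+1)! < |t - sₙ| ≤ 1/(q w). The tolerance
    -- 1/(n+2)! in the convergence hypothesis is the one that `taylorTerm<distance` asks for.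
    den-bound : ∀ w → (∀ j → + w ℤ.* den (drop (suc k) c) j ℤ.≤ den c (suc (k ℕ.+ j))) → .{{ℕ.NonZero w}} →
      ℤ.∣ den c k ∣ ℕ.* w ℕ.< suc n !
    den-bound w@(suc _) growth
      with N , near ← c-e (taylorTerm (2 ℕ.+ n)) (positive⁻¹ _ {{taylorTerm-pos (2 ℕ.+ n)}}) =
      ℤ.drop‿+<+ (subst (ℤ._< + (suc n !)) den*w≡ (fromℤ-cancel-< (*-cancelˡ-<-nonNeg u {{pos⇒nonNeg u {{taylorTerm-pos (suc n)}}}} (begin-strict
        u * fromℤ (den c k ℤ.* + w)
          <⟨ *-monoˡ-<-pos (fromℤ (den c k ℤ.* + w)) {{fromℤ-pos den*w>0}}
               (taylorTerm<distance n m (truncation c m) (ℕ.≤-trans (ℕ.m≤n+m (2 ℕ.+ n) N) j≤m)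
                 (near m (ℕ.≤-trans (ℕ.m≤m+n N (2 ℕ.+ n)) j≤m))) ⟩
        ∣ truncation c m - partialSum n ∣ * fromℤ (den c k ℤ.* + w)
          ≡⟨ cong (λ z → ∣ truncation c m - z ∣ * fromℤ (den c k ℤ.* + w)) sₙ≡ ⟩
        ∣ truncation c m - truncation c k ∣ * fromℤ (den c k ℤ.* + w)
          ≤⟨ truncation-distance c k j w (growth j) ⟩
        1ℚ
          ≡⟨ taylorTerm-* (suc n) ⟨
        u * fromℤ (+ (suc n !)) ∎))))
      where
      open ≤-Reasoning
      u = taylorTerm (suc n)
      -- The sum puts `m` beyond both `N`, for closeness, and `2 ℕ.+ n`, for the lower bound on the
      -- distance.
      j = N ℕ.+ (2 ℕ.+ n)
      m = suc (k ℕ.+ j)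
      j≤m : j ℕ.≤ m
      j≤m = ℕ.m≤n⇒m≤1+n (ℕ.m≤n+m j k)
      den*w≡ : den c k ℤ.* + w ≡ + (ℤ.∣ den c k ∣ ℕ.* w)
      den*w≡ = trans (cong (ℤ._* + w) (sym (+∣den∣ c k))) (sym (ℤ.pos-* ℤ.∣ den c k ∣ w))
      den*w>0 : 0ℤ ℤ.< den c k ℤ.* + w
      den*w>0 = ℤ.*-monoʳ-<-pos (+ w) (den-pos c k)

  -- The final alternative separates k = 0 from k ≥ 1. At k = 0 the denominator is 1 and the next
  -- one is a₁, which may also be 1, so the bound with q + 1 is claimed only from k = 1 on.
  convergent⇒ : ∀ {n} → partialSum n IsConvergentOf e →
    ∃[ q ] (ℕ.NonZero q × n ! ∣ q ℕ.* numerator n × q ℕ.* q ℕ.< suc n ! × (q ≡ 1 ⊎ q ℕ.* suc q ℕ.< suc n !))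
  convergent⇒ {n} (c , c-e , k , sₙ≡) =
    q , q≢0 , n!∣den*numerator n c k c-e sₙ≡ ,
    den-bound n c k c-e sₙ≡ q (λ j → weaken k j (+∣den∣ c k) (den-growth c k j)) {{q≢0}} , strict k sₙ≡
    where
    q = ℤ.∣ den c k ∣
    q≢0 : ℕ.NonZero q
    q≢0 = ℕ.≢-nonZero (λ q≡0 → ℤ.<-irrefl (sym (ℤ.∣i∣≡0⇒i≡0 q≡0)) (den-pos c k))
    weaken : ∀ {a b} k j → a ≡ b → b ℤ.* den (drop (suc k) c) j ℤ.≤ den c (suc (k ℕ.+ j)) →
      a ℤ.* den (drop (suc k) c) j ℤ.≤ den c (suc (k ℕ.+ j))
    weaken _ _ refl h = h
    strict : ∀ k → partialSum n ≡ truncation c k →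
      ℤ.∣ den c k ∣ ≡ 1 ⊎ ℤ.∣ den c k ∣ ℕ.* suc ℤ.∣ den c k ∣ ℕ.< suc n !
    strict zero    _   = inj₁ refl
    -- `den c (suc k)` is `num (tail c) k`, so the sharper `num-growth` applies and allows w = q +
    -- 1.
    strict (suc k) sₙ≡ = inj₂ (den-bound n c (suc k) c-e sₙ≡ (suc ℤ.∣ den c (suc k) ∣)
      (λ j → weaken (suc k) j (trans (ℤ.+-comm 1ℤ (+ ℤ.∣ den c (suc k) ∣)) (cong (ℤ._+ 1ℤ) (+∣den∣ c (suc k))))
               (num-growth (tail c) k j (quotient>0 c 0))))

-- Exclusion of small indices and conclusion

module _ where
  open import Data.Nat.Base using (_+_; _*_; _<_; NonZero)
  open import Data.Nat.Properties

  convergent⇒smallDenominator : ∀ n → partialSum n IsConvergentOf e → SmallDenominator n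
  convergent⇒smallDenominator n h =
    let q , q≢0 , n!∣q*numerator , q²< , _ = convergent⇒ {n} h
    in smallDenominator n q n!∣q*numerator {{q≢0}} q²<

  -- Divisibility rules out q = 1, and q ≥ 2 gives q (q+1) ≥ 6 = 3!. The weaker q² < 6 would still
  -- admit q = 2.
  no-denominator-of-5/2 : ∀ q .{{_ : NonZero q}} → 2 ∣ q * 5 → ¬ (q ≡ 1 ⊎ q * suc q < 6)
  no-denominator-of-5/2 1 2∣5 _ = toWitnessFalse {a? = 2 ∣? 5} _ 2∣5
  no-denominator-of-5/2 (suc (suc q)) _ (inj₂ q[q+1]<6) =
    <⇒≱ q[q+1]<6 (*-mono-≤ {2} {2 + q} {3} {3 + q} (m≤m+n 2 q) (m≤m+n 3 q))

  s₂-not-convergent : ¬ (partialSum 2 IsConvergentOf e)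
  s₂-not-convergent h =
    let q , q≢0 , 2∣q*5 , _ , q≡1⊎q[q+1]<6 = convergent⇒ {2} h
    in no-denominator-of-5/2 q {{q≢0}} 2∣q*5 q≡1⊎q[q+1]<6

  -- The fractions 65/24, 326/120 and 13700/5040 for s₄, s₅ and s₇ reduce by 1, 2 and 20, so
  -- `SmallDenominator` would demand 24 < 5, 120 < 24 and 5040 < 3200.
  s₄-not-convergent : ¬ (partialSum 4 IsConvergentOf e)
  s₄-not-convergent h = toWitnessFalse {a? = 4 ! <? 5 * (cancelled 4 * cancelled 4)} _ (convergent⇒smallDenominator 4 h)

  s₅-not-convergent : ¬ (partialSum 5 IsConvergentOf e)
  s₅-not-convergent h = toWitnessFalse {a? = 5 ! <? 6 * (cancelled 5 * cancelled 5)} _ (convergent⇒smallDenominator 5 h)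

  s₇-not-convergent : ¬ (partialSum 7 IsConvergentOf e)
  s₇-not-convergent h = toWitnessFalse {a? = 7 ! <? 8 * (cancelled 7 * cancelled 7)} _ (convergent⇒smallDenominator 7 h)

theorem3p1 : (n : ℕ) →
    ¬ (partialSum n IsConvergentOf e
    × partialSum (suc n) IsConvergentOf e
    × partialSum (suc (suc n)) IsConvergentOf e)
theorem3p1 0 (_ , _ , h) = s₂-not-convergent h
theorem3p1 1 (_ , h , _) = s₂-not-convergent h
theorem3p1 2 (h , _ , _) = s₂-not-convergent h
theorem3p1 3 (_ , h , _) = s₄-not-convergent h
theorem3p1 4 (h , _ , _) = s₄-not-convergent h
theorem3p1 5 (h , _ , _) = s₅-not-convergent h
theorem3p1 6 (_ , h , _) = s₇-not-convergent h
theorem3p1 7 (h , _ , _) = s₇-not-convergent h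
theorem3p1 n@(suc (suc (suc (suc (suc (suc (suc (suc k)))))))) (h₀ , h₁ , h₂) =
  ℕ.<⇒≱ (three-small⇒n!< n (convergent⇒smallDenominator n h₀)
                         (convergent⇒smallDenominator (1 ℕ.+ n) h₁)
                         (convergent⇒smallDenominator (2 ℕ.+ n) h₂))
      (factorial-bound k)
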